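{- For every even integer $k\geq 4$, there exists a permutation graph $G$ with a matching $M$ in it such that the only alternating cycle with respect to $M$ in $G$ has length $k$.
   Context: Graphs are finite, simple, undirected. For a permutation $\pi$ of $\{1,\dots,n\}$, $G_\pi$ has vertex set $\{1,\dots,n\}$ and edges $ij$ with $(i-j)(\pi(i)-\pi(j))<0$; a permutation graph is a graph isomorphic to some $G_\pi$. A matching is a set of pairwise vertex-disjoint edges. Given a matching $M$, an alternating cycle with respect to $M$ is an even cycle of $G$ in which every second edge belongs to $M$. -}

module Defs where

open import Data.Fin.Base using (Fin; toℕ)
open import Data.Fin.Permutation using (Permutation′; _⟨$⟩ʳ_)
open import Data.Integer.Base using (ℤ; +_; 0ℤ; _-_; -_; _*_; _<_)
open import Data.Integer.Properties
  using (_<?_; <-irrefl; +-inverseʳ; neg-distribˡ-*; neg-distribʳ-*; neg-involutive; ⊖-swap; m-n≡m⊖n)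
open import Data.Nat.Base using (ℕ; suc; _≤_)
open import Data.Nat.Divisibility using (_∣_; _∤_)
open import Data.Nat.DivMod using (_mod_)
open import Data.Product.Base using (Σ-syntax; ∃-syntax; _×_)
open import Data.Sum.Base using (_⊎_)
open import Function.Base using (_on_)
open import Function.Bundles using (_↔_; _⇔_; Inverse)
open import Function.Definitions using (Injective)
open import Level using (0ℓ)
open import Relation.Binary.Core using (Rel)
open import Relation.Binary.Definitions using (Decidable; Irreflexive; Symmetric)
open import Relation.Binary.PropositionalEquality
  using (_≡_; _≢_; refl; sym; trans; cong; cong₂; subst)

infix 4 _≅_ _≈_

record Graph : Set₁ where
  field
    order  : ℕ
    Adj    : Rel (Fin order) 0ℓ
    adj?   : Decidable Adj
    symm   : Symmetric Adj
    irrefl : Irreflexive _≡_ Adj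

  Vertex : Set
  Vertex = Fin order

record _≅_ (G H : Graph) : Set where
  private
    module G = Graph G
    module H = Graph H
  field
    bijection : G.Vertex ↔ H.Vertex
    preserves : ∀ u v → G.Adj u v ⇔ (H.Adj on Inverse.to bijection) u v

-- The points are 0, …, n-1 rather than 1, …, n; only differences of points
-- matter.
diff : ∀ {n} → Fin n → Fin n → ℤ
diff i j = + toℕ i - + toℕ j

module _ {n : ℕ} (π : Permutation′ n) where

  Inversion : Rel (Fin n) 0ℓ
  Inversion i j = diff i j * diff (π ⟨$⟩ʳ i) (π ⟨$⟩ʳ j) < 0ℤ

  private
    diff-swap : (i j : Fin n) → diff i j ≡ - diff j i
    diff-swap i j =
      trans (m-n≡m⊖n (toℕ i) (toℕ j))
      (trans (⊖-swap (toℕ i) (toℕ j)) (cong -_ (sym (m-n≡m⊖n (toℕ j) (toℕ i)))))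

    neg*neg : ∀ x y → (- x) * (- y) ≡ x * y
    neg*neg x y =
      trans (sym (neg-distribˡ-* x (- y)))
      (trans (cong -_ (sym (neg-distribʳ-* x y))) (neg-involutive (x * y)))

    product-symm : ∀ i j →
      diff i j * diff (π ⟨$⟩ʳ i) (π ⟨$⟩ʳ j) ≡ diff j i * diff (π ⟨$⟩ʳ j) (π ⟨$⟩ʳ i)
    product-symm i j =
      trans (cong₂ _*_ (diff-swap i j) (diff-swap (π ⟨$⟩ʳ i) (π ⟨$⟩ʳ j)))
      (neg*neg (diff j i) (diff (π ⟨$⟩ʳ j) (π ⟨$⟩ʳ i)))

    inversion-irrefl : Irreflexive _≡_ Inversion
    inversion-irrefl {i} refl =
      <-irrefl (cong (_* diff (π ⟨$⟩ʳ i) (π ⟨$⟩ʳ i)) (+-inverseʳ (+ toℕ i)))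

  inversionGraph : Graph
  inversionGraph = record
    { order  = n
    ; Adj    = Inversion
    ; adj?   = λ i j → (diff i j * diff (π ⟨$⟩ʳ i) (π ⟨$⟩ʳ j)) <? 0ℤ
    ; symm   = λ {i} {j} → subst (_< 0ℤ) (product-symm i j)
    ; irrefl = inversion-irrefl
    }

IsPermutationGraph : Graph → Set
IsPermutationGraph G = ∃[ n ] Σ[ π ∈ Permutation′ n ] G ≅ inversionGraph π

-- Equality of the unordered pairs {u , v} and {x , y}.
SamePair : {A : Set} → A → A → A → A → Set
SamePair u v x y = (u ≡ x × v ≡ y) ⊎ (u ≡ y × v ≡ x)

DisjointPairs : {A : Set} → A → A → A → A → Set
DisjointPairs u v x y = u ≢ x × u ≢ y × v ≢ x × v ≢ y

-- A set of undirected edges is given by a symmetric relation on vertices.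
record Matching (G : Graph) : Set₁ where
  open Graph G using (Vertex; Adj)
  field
    Mem      : Rel Vertex 0ℓ
    mem?     : Decidable Mem
    symm     : Symmetric Mem
    edges    : ∀ {u v} → Mem u v → Adj u v
    disjoint : ∀ {u v x y} → Mem u v → Mem x y →
               SamePair u v x y ⊎ DisjointPairs u v x y

next : ∀ {n} → Fin n → Fin n
next {suc n} i = suc (toℕ i) mod suc n

-- A traversal of a cycle; the i-th edge joins vertex i and vertex (next i).
record Cycle (G : Graph) : Set where
  open Graph G using (Vertex; Adj)
  field
    length    : ℕ
    3≤length  : 3 ≤ length
    vertex    : Fin length → Vertex
    injective : Injective _≡_ _≡_ vertex
    adjacent  : ∀ i → Adj (vertex i) (vertex (next i))

  HasEdge : Rel Vertex 0ℓ
  HasEdge u v = ∃[ i ] SamePair u v (vertex i) (vertex (next i))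

record AlternatingCycle {G : Graph} (M : Matching G) : Set where
  open Matching M using (Mem)
  field
    cycle : Cycle G
  open Cycle cycle public
  field
    even        : 2 ∣ length
    alternating : (∀ i → 2 ∣ toℕ i → Mem (vertex i) (vertex (next i)))
                ⊎ (∀ i → 2 ∤ toℕ i → Mem (vertex i) (vertex (next i)))

-- Cycles are subgraphs, so traversals that differ in starting vertex or
-- direction are the same cycle; a cycle is determined by its edge set.
_≈_ : {G : Graph} {M : Matching G} → Rel (AlternatingCycle M) 0ℓ
C ≈ D = ∀ u v → AlternatingCycle.HasEdge C u v ⇔ AlternatingCycle.HasEdge D u v

{-# OPTIONS --safe #-}
module Submission where

-- An induced cycle of length above 4 is not a permutation graph, so the cycle
-- of length k = 2(n + 2) is given chords: walking round it from a vertex v₀ as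
-- v₀, v₁, …, add the rungs joining vᵢ to v₋ᵢ.  The resulting ladder with a
-- triangle at each end is a permutation graph.  Let M be every second edge of
-- the cycle.  Between two consecutive columns {vᵢ , v₋ᵢ} exactly one of the two
-- edges is in M.  Going left from any visited vertex, an alternating cycle D
-- reaches v₀, and both cycle edges at v₀ are in D.  From there D grows along
-- both sides at once: in each new column one of the two vertices already has
-- its non-matching edge, so the other cannot use the rung and D must follow
-- the ladder's sides to the far end.

open import Defs
open import Data.Empty using (⊥-elim)
open import Data.Fin.Base using (Fin; zero; suc; toℕ; fromℕ; fromℕ<; inject₁)
open import Data.Fin.Permutation using (Permutation′; _⟨$⟩ʳ_; permutation)
import Data.Fin.Properties as Fin
open import Data.Fin.Properties
  using (toℕ<n; toℕ-fromℕ; toℕ-fromℕ<; toℕ-inject₁; toℕ-injective)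
open import Data.Integer.Base using (+[1+_]; -[1+_]; -<+; +<+; _⊖_)
import Data.Integer.Properties as ℤ
open import Data.Nat.Base
  using (ℕ; zero; suc; _+_; _*_; _∸_; _%_; _<_; _≤_; s≤s; s≤s⁻¹; z≤n)
open import Data.Nat.Divisibility
  using (_∣_; _∤_; divides; divides-refl; _∣0; _∣?_; ∣-refl; ∣1⇒≡1; ∣m+n∣m⇒∣n; ∣m∣n⇒∣m+n)
open import Data.Nat.DivMod using (m<n⇒m%n≡m; n%n≡0)
open import Data.Nat.Properties
open import Data.Product.Base using (Σ-syntax; ∃-syntax; _×_; _,_)
open import Data.Sum.Base using (_⊎_; inj₁; inj₂; map₂)
open import Function.Base using (_∘_; id)
open import Function.Bundles using (_⇔_; mk⇔; Equivalence)
open import Function.Construct.Identity using (↔-id)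
open import Relation.Binary.Definitions using (tri<; tri≈; tri>)
open import Relation.Binary.PropositionalEquality
open import Relation.Nullary using (¬_; yes; no; contradiction)

-- Inversions as order reversals in the natural numbers.

Crossing : (p q p′ q′ : ℕ) → Set
Crossing p q p′ q′ = p < q × q′ < p′

⊖-negative : ∀ {m n} → m < n → ∃[ d ] m ⊖ n ≡ -[1+ d ]
⊖-negative {zero}  {suc n} _         = n , refl
⊖-negative {suc m} {suc n} (s≤s m<n) with d , eq ← ⊖-negative m<n =
  d , trans (ℤ.[1+m]⊖[1+n]≡m⊖n m n) eq

⊖-positive : ∀ {m n} → n < m → ∃[ d ] m ⊖ n ≡ +[1+ d ]
⊖-positive {suc m} {zero}  _         = m , refl
⊖-positive {suc m} {suc n} (s≤s n<m) with d , eq ← ⊖-positive n<m =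
  d , trans (ℤ.[1+m]⊖[1+n]≡m⊖n m n) eq

module _ {n : ℕ} (π : Permutation′ n) where

  private
    diff-⊖ : (i j : Fin n) → diff i j ≡ toℕ i ⊖ toℕ j
    diff-⊖ i j = ℤ.[+m]-[+n]≡m⊖n (toℕ i) (toℕ j)

  crossing⇒inversion : ∀ {i j} →
    Crossing (toℕ i) (toℕ j) (toℕ (π ⟨$⟩ʳ i)) (toℕ (π ⟨$⟩ʳ j)) → Inversion π i j
  crossing⇒inversion {i} {j} (i<j , πj<πi)
    with d , eq ← ⊖-negative i<j | e , eq′ ← ⊖-positive πj<πi
    rewrite diff-⊖ i j | eq | diff-⊖ (π ⟨$⟩ʳ i) (π ⟨$⟩ʳ j) | eq′ = -<+

  -- Ties and differences of equal sign make the product nonnegative, so only the two mixed sign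
  -- patterns survive.
  inversion⇒crossing : ∀ {i j} → Inversion π i j →
    Crossing (toℕ i) (toℕ j) (toℕ (π ⟨$⟩ʳ i)) (toℕ (π ⟨$⟩ʳ j)) ⊎
    Crossing (toℕ j) (toℕ i) (toℕ (π ⟨$⟩ʳ j)) (toℕ (π ⟨$⟩ʳ i))
  inversion⇒crossing {i} {j} inv
    with <-cmp (toℕ i) (toℕ j) | <-cmp (toℕ (π ⟨$⟩ʳ i)) (toℕ (π ⟨$⟩ʳ j))
  ... | tri< i<j _ _ | tri> _ _ πj<πi = inj₁ (i<j , πj<πi)
  ... | tri> _ _ j<i | tri< πi<πj _ _ = inj₂ (j<i , πi<πj)
  ... | tri≈ _ i≡j _ | _
    with refl ← toℕ-injective i≡j = ⊥-elim (Graph.irrefl (inversionGraph π) {i} refl inv)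
  ... | _ | tri≈ _ πi≡πj _
    rewrite diff-⊖ (π ⟨$⟩ʳ i) (π ⟨$⟩ʳ j) | πi≡πj | ℤ.n⊖n≡0 (toℕ (π ⟨$⟩ʳ j))
          | ℤ.*-zeroʳ (diff i j)
    with +<+ () ← inv
  ... | tri< i<j _ _ | tri< πi<πj _ _
    with d , eq ← ⊖-negative i<j | e , eq′ ← ⊖-negative πi<πj
    rewrite diff-⊖ i j | eq | diff-⊖ (π ⟨$⟩ʳ i) (π ⟨$⟩ʳ j) | eq′
    with +<+ () ← inv
  ... | tri> _ _ j<i | tri> _ _ πj<πi
    with d , eq ← ⊖-positive j<i | e , eq′ ← ⊖-positive πj<πi
    rewrite diff-⊖ i j | eq | diff-⊖ (π ⟨$⟩ʳ i) (π ⟨$⟩ʳ j) | eq′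
    with +<+ () ← inv

-- Cyclic successor and parity.

toℕ-next : ∀ {n} (i : Fin n) →
  toℕ (next i) ≡ suc (toℕ i) ⊎ (suc (toℕ i) ≡ n × toℕ (next i) ≡ 0)
toℕ-next {suc n} i with m≤n⇒m<n∨m≡n (toℕ<n i)
... | inj₁ lt = inj₁ (trans (toℕ-fromℕ< _) (m<n⇒m%n≡m lt))
... | inj₂ eq = inj₂ (eq , trans (toℕ-fromℕ< _)
                  (trans (cong (_% suc n) eq) (n%n≡0 (suc n))))

next-injective : ∀ {n} {i j : Fin n} → next i ≡ next j → i ≡ j
next-injective {i = i} {j} eq with toℕ-next i | toℕ-next j
... | inj₁ p       | inj₁ q       =
  toℕ-injective (suc-injective (trans (sym p) (trans (cong toℕ eq) q)))
... | inj₂ (p , _) | inj₂ (q , _) = toℕ-injective (suc-injective (trans p (sym q)))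
... | inj₁ p       | inj₂ (_ , q) = contradiction (trans (sym p) (trans (cong toℕ eq) q)) λ ()
... | inj₂ (_ , p) | inj₁ q       = contradiction (trans (sym q) (trans (cong toℕ (sym eq)) p)) λ ()

next-surjective : ∀ {n} (i : Fin n) → ∃[ j ] next j ≡ i
next-surjective {suc n} zero with toℕ-next (fromℕ n)
... | inj₂ (_ , p) = fromℕ n , toℕ-injective p
... | inj₁ p       = contradiction (toℕ<n (next (fromℕ n)))
  (<-irrefl (trans p (cong suc (toℕ-fromℕ n))))
next-surjective {suc n} (suc i) with toℕ-next (inject₁ i)
... | inj₁ p       = inject₁ i , toℕ-injective (trans p (cong suc (toℕ-inject₁ i)))
... | inj₂ (p , _) = contradiction (toℕ<n i)
  (<-irrefl (trans (sym (toℕ-inject₁ i)) (suc-injective p)))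

-- On two points the double successor would be the identity. The bound keeps two consecutive steps
-- of a cycle from being the same edge.
next∘next≢ : ∀ {n} → 3 ≤ n → (i : Fin n) → next (next i) ≢ i
next∘next≢ 3≤n i eq with toℕ-next i | toℕ-next (next i)
... | inj₁ p       | inj₁ q       =
  contradiction (trans (trans (cong suc (sym p)) (sym q)) (cong toℕ eq))
    (<⇒≢ (m<n⇒m<1+n (n<1+n (toℕ i))) ∘ sym)
... | inj₁ p       | inj₂ (q , r) with 3≤n
...   | s≤s (s≤s (s≤s _)) = contradiction
  (trans (sym q) (cong suc (trans p (cong suc (trans (cong toℕ (sym eq)) r))))) λ ()
next∘next≢ (s≤s (s≤s (s≤s _))) i eq | inj₂ (p , r) | inj₁ q =
  contradiction (trans (sym p) (cong suc (trans (cong toℕ (sym eq)) (trans q (cong suc r))))) λ ()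
next∘next≢ (s≤s (s≤s (s≤s _))) i eq | inj₂ (p , r) | inj₂ (q , _) =
  contradiction (trans (sym q) (cong suc r)) λ ()

suc-odd : ∀ {n} → 2 ∣ n → 2 ∤ suc n
suc-odd {n} 2∣n 2∣1+n with () ← ∣1⇒≡1 (∣m+n∣m⇒∣n (subst (2 ∣_) (+-comm 1 n) 2∣1+n) 2∣n)

suc-even : ∀ {n} → 2 ∤ n → 2 ∣ suc n
suc-even {zero}        2∤n = contradiction (2 ∣0) 2∤n
suc-even {suc zero}    2∤n = ∣-refl
suc-even {suc (suc n)} 2∤n = ∣m∣n⇒∣m+n ∣-refl (suc-even (2∤n ∘ ∣m∣n⇒∣m+n ∣-refl))

-- The evenness of `n` serves the wrap-around: an even last index would make `n` odd.
next-odd : ∀ {n} → 2 ∣ n → (i : Fin n) → 2 ∣ toℕ i → 2 ∤ toℕ (next i)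
next-odd 2∣n i 2∣i 2∣next with toℕ-next i
... | inj₁ p       = suc-odd 2∣i (subst (2 ∣_) p 2∣next)
... | inj₂ (p , _) = suc-odd 2∣i (subst (2 ∣_) (sym p) 2∣n)

next-even : ∀ {n} (i : Fin n) → 2 ∤ toℕ i → 2 ∣ toℕ (next i)
next-even i 2∤i with toℕ-next i
... | inj₁ p       = subst (2 ∣_) (sym p) (suc-even 2∤i)
... | inj₂ (_ , p) = subst (2 ∣_) (sym p) (2 ∣0)

-- Matching edges and free edges of an alternating cycle.

Mem-functional : ∀ {G} (M : Matching G) {u v w} →
  Matching.Mem M u v → Matching.Mem M u w → v ≡ w
Mem-functional M uv uw with Matching.disjoint M uv uw
... | inj₁ (inj₁ (_ , v≡w))   = v≡w
... | inj₁ (inj₂ (u≡w , v≡u)) = trans v≡u u≡w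
... | inj₂ (u≢u , _)          = contradiction refl u≢u

SamePair-sym : ∀ {A : Set} {u v x y : A} → SamePair u v x y → SamePair v u x y
SamePair-sym (inj₁ (p , q)) = inj₂ (q , p)
SamePair-sym (inj₂ (p , q)) = inj₁ (q , p)

module Alternation {G : Graph} {M : Matching G} (D : AlternatingCycle M) where
  open Graph G using (Vertex; Adj)
  open Matching M using (Mem; mem?)
  open AlternatingCycle D

  MatchedStep : Fin length → Set
  MatchedStep i = Mem (vertex i) (vertex (next i))

  -- An alternating cycle is only required to have every second edge in `M`. The other edges lie
  -- outside, because two matching edges at one vertex coincide and the cycle would turn back on
  -- itself.
  matched⇒unmatched : ∀ i → MatchedStep i → ¬ MatchedStep (next i)
  matched⇒unmatched i m m′ = next∘next≢ 3≤length i
    (injective (Mem-functional M m′ (Matching.symm M m)))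

  unmatched⇒matched : ∀ i → ¬ MatchedStep i → MatchedStep (next i)
  unmatched⇒matched i ¬m with 2 ∣? toℕ i | alternating
  ... | yes 2∣i | inj₁ f = contradiction (f i 2∣i) ¬m
  ... | yes 2∣i | inj₂ f = f (next i) (next-odd even i 2∣i)
  ... | no  2∤i | inj₁ f = f (next i) (next-even i 2∤i)
  ... | no  2∤i | inj₂ f = contradiction (f i 2∤i) ¬m

  -- A cycle edge outside `M`, in either direction. Each vertex of the cycle has exactly one and its
  -- other cycle edge is in `M`, so the free edges determine the cycle.
  FreeEdge : Vertex → Vertex → Set
  FreeEdge u w = ∃[ i ] ¬ MatchedStep i × SamePair u w (vertex i) (vertex (next i))

  FreeEdge-sym : ∀ {u w} → FreeEdge u w → FreeEdge w u
  FreeEdge-sym (i , ¬m , s) = i , ¬m , SamePair-sym s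

  FreeEdge⇒Adj : ∀ {u w} → FreeEdge u w → Adj u w
  FreeEdge⇒Adj (i , _ , inj₁ (refl , refl)) = adjacent i
  FreeEdge⇒Adj (i , _ , inj₂ (refl , refl)) = Graph.symm G (adjacent i)

  FreeEdge⇒¬Mem : ∀ {u w} → FreeEdge u w → ¬ Mem u w
  FreeEdge⇒¬Mem (_ , ¬m , inj₁ (refl , refl)) = ¬m
  FreeEdge⇒¬Mem (_ , ¬m , inj₂ (refl , refl)) = ¬m ∘ Matching.symm M

  FreeEdge-functional : ∀ {u v w} → FreeEdge u v → FreeEdge u w → v ≡ w
  FreeEdge-functional (i , ¬m , inj₁ (p , refl)) (j , ¬m′ , inj₁ (q , refl)) =
    cong (vertex ∘ next) (injective (trans (sym p) q))
  FreeEdge-functional (i , ¬m , inj₂ (p , refl)) (j , ¬m′ , inj₂ (q , refl)) =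
    cong vertex (next-injective (injective (trans (sym p) q)))
  -- One free step leaves the vertex and the other enters it; being consecutive, they cannot both be
  -- unmatched.
  FreeEdge-functional (i , ¬m , inj₁ (p , _)) (j , ¬m′ , inj₂ (q , _))
    with refl ← injective (trans (sym p) q) = contradiction (unmatched⇒matched j ¬m′) ¬m
  FreeEdge-functional (i , ¬m , inj₂ (p , _)) (j , ¬m′ , inj₁ (q , _))
    with refl ← injective (trans (sym p) q) = contradiction (unmatched⇒matched i ¬m) ¬m′

  freeEdge : ∀ i → ∃[ w ] FreeEdge (vertex i) w
  freeEdge i with mem? (vertex i) (vertex (next i)) | next-surjective i
  ... | no  ¬m | _        = _ , i , ¬m , inj₁ (refl , refl)
  ... | yes m  | j , refl = _ , j , (λ m′ → matched⇒unmatched j m′ m) , inj₂ (refl , refl)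

  matchedEdge : ∀ i → ∃[ w ] Mem (vertex i) w × HasEdge (vertex i) w
  matchedEdge i with mem? (vertex i) (vertex (next i)) | next-surjective i
  ... | yes m  | _        = _ , m , i , inj₁ (refl , refl)
  ... | no  ¬m | j , refl with mem? (vertex j) (vertex (next j))
  ...   | yes m  = _ , Matching.symm M m , j , inj₂ (refl , refl)
  ...   | no ¬m′ = contradiction (unmatched⇒matched j ¬m′) ¬m

  HasEdge⇒freeEdge : ∀ {u v} → HasEdge u v → ∃[ w ] FreeEdge v w
  HasEdge⇒freeEdge (i , inj₁ (_ , refl)) = freeEdge (next i)
  HasEdge⇒freeEdge (i , inj₂ (_ , refl)) = freeEdge i

  -- A vertex with a free edge lies on the cycle, and the matching edge of the cycle there is the
  -- only edge of `M` at that vertex.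
  FreeEdge⇒matched : ∀ {u w m} → FreeEdge u w → Mem u m → HasEdge u m
  FreeEdge⇒matched (i , _ , inj₁ (refl , _)) um with w , um′ , e ← matchedEdge i
    with refl ← Mem-functional M um um′ = e
  FreeEdge⇒matched (i , _ , inj₂ (refl , _)) um with w , um′ , e ← matchedEdge (next i)
    with refl ← Mem-functional M um um′ = e

  FreeEdge⇒HasEdge : ∀ {u w} → FreeEdge u w → HasEdge u w
  FreeEdge⇒HasEdge (i , _ , s) = i , s

  HasEdge⇒Mem⊎FreeEdge : ∀ {u v} → HasEdge u v → Mem u v ⊎ FreeEdge u v
  HasEdge⇒Mem⊎FreeEdge (i , s) with mem? (vertex i) (vertex (next i)) | s
  ... | no ¬m | _                  = inj₂ (i , ¬m , s)
  ... | yes m | inj₁ (refl , refl) = inj₁ m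
  ... | yes m | inj₂ (refl , refl) = inj₁ (Matching.symm M m)

  firstFreeEdge : ∃[ u ] ∃[ w ] FreeEdge u w
  firstFreeEdge = helper 3≤length vertex freeEdge
    where
    -- With the length a variable, splitting the bound exposes an index `zero`.
    helper : ∀ {l} → 3 ≤ l → (v : Fin l → Vertex) → (∀ i → ∃[ w ] FreeEdge (v i) w) →
             ∃[ u ] ∃[ w ] FreeEdge u w
    helper (s≤s _) v f = v zero , f zero

-- Points on two sides and their codes.

-- lo i and hi i are the vertices 2i and 2i + 1.
data Point : Set where
  lo hi : ℕ → Point

level : Point → ℕ
level (lo i) = i
level (hi i) = i

code : Point → ℕ
code (lo i) = i * 2
code (hi i) = suc (i * 2)

lift₁ : Point → Point
lift₁ (lo i) = lo (suc i)
lift₁ (hi i) = hi (suc i)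

decode : ℕ → Point
decode zero          = lo 0
decode (suc zero)    = hi 0
decode (suc (suc k)) = lift₁ (decode k)

code-decode : ∀ k → code (decode k) ≡ k
code-decode zero          = refl
code-decode (suc zero)    = refl
code-decode (suc (suc k)) with decode k | code-decode k
... | lo i | eq = cong (2 +_) eq
... | hi i | eq = cong (2 +_) eq

decode-code : ∀ p → decode (code p) ≡ p
decode-code (lo zero)    = refl
decode-code (hi zero)    = refl
decode-code (lo (suc i)) = cong lift₁ (decode-code (lo i))
decode-code (hi (suc i)) = cong lift₁ (decode-code (hi i))

i*2<1+j*2⇒i≤j : ∀ i j → i * 2 < suc (j * 2) → i ≤ j
i*2<1+j*2⇒i≤j i j (s≤s le) = *-cancelʳ-≤ i j 2 le

1+i*2<j*2⇒i<j : ∀ i j → suc (i * 2) < j * 2 → i < j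
1+i*2<j*2⇒i<j i j lt = *-cancelʳ-< 2 i j (<-trans (n<1+n _) lt)

i<j⇒1+i*2<j*2 : ∀ {i j} → i < j → suc (i * 2) < j * 2
i<j⇒1+i*2<j*2 = *-monoˡ-≤ 2

code<⇒level< : ∀ p j → code p < j * 2 → level p < j
code<⇒level< (lo i) j lt = *-cancelʳ-< 2 i j lt
code<⇒level< (hi i) j lt = 1+i*2<j*2⇒i<j i j lt

level<⇒code< : ∀ p j → level p < j → code p < j * 2
level<⇒code< (lo i) j lt = *-monoˡ-< 2 lt
level<⇒code< (hi i) j lt = i<j⇒1+i*2<j*2 lt

partner : Point → Point
partner (lo i) = hi i
partner (hi i) = lo i

partner-involutive : ∀ p → partner (partner p) ≡ p
partner-involutive (lo i) = refl
partner-involutive (hi i) = refl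

-- The ladder and its permutation.

module Ladder (n : ℕ) where

  Bounded : Point → Set
  Bounded p = level p ≤ suc n

  -- Exchanges lo i and hi (i + 1); hi 0 and lo (n + 1) have no counterpart.
  σ : Point → Point
  σ (hi zero)    = hi zero
  σ (hi (suc i)) = lo i
  σ (lo i) with i ≟ suc n
  ... | yes _ = lo i
  ... | no  _ = hi (suc i)

  σ-last : σ (lo (suc n)) ≡ lo (suc n)
  σ-last with suc n ≟ suc n
  ... | yes _ = refl
  ... | no ≢  = contradiction refl ≢

  σ-lo : ∀ {i} → i ≢ suc n → σ (lo i) ≡ hi (suc i)
  σ-lo {i} i≢ with i ≟ suc n
  ... | yes i≡ = contradiction i≡ i≢
  ... | no _   = refl

  σ-involutive : ∀ p → Bounded p → σ (σ p) ≡ p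
  σ-involutive (hi zero)    _ = refl
  σ-involutive (hi (suc i)) h = σ-lo (<⇒≢ h)
  σ-involutive (lo i)       h with i ≟ suc n
  ... | yes refl = σ-last
  ... | no _     = refl

  σ-bounded : ∀ p → Bounded p → Bounded (σ p)
  σ-bounded (hi zero)    h = h
  σ-bounded (hi (suc i)) h = <⇒≤ h
  σ-bounded (lo i)       h with i ≟ suc n
  ... | yes _ = h
  ... | no i≢ = ≤∧≢⇒< h i≢

  -- The edges of the intended cycle outside the matching. Here v₀ is `hi 0`, the columns are the
  -- pairs `lo i`, `hi (suc i)`, and the far end is `lo (suc n)`. A rail and the matching edge at
  -- level i + 1 join two consecutive columns; `bottom` and `top` lie in the end triangles.
  data CycleEdge : Point → Point → Set where
    bottom : CycleEdge (hi 0) (hi 1)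
    rail   : ∀ {i} → i < n → CycleEdge (lo i) (hi (2 + i))
    top    : CycleEdge (lo n) (lo (suc n))

  data Unmatched : Point → Point → Set where
    rung   : ∀ {i} → Unmatched (lo i) (hi (suc i))
    cyclic : ∀ {p q} → CycleEdge p q → Unmatched p q

  data Edge : Point → Point → Set where
    matched   : ∀ {i} → Edge (lo i) (hi i)
    unmatched : ∀ {p q} → Unmatched p q → Edge p q

  _⋈_ : Point → Point → Set
  p ⋈ q = Crossing (code p) (code q) (code (σ p)) (code (σ q))

  -- Apart from its two fixed points, `σ` adds 3 to the code of each `lo` and subtracts 3 from that
  -- of each `hi`. Points moved alike keep their order, so a crossing has `lo i` before `hi j` with
  -- j at most i + 2, or involves a fixed point.
  ⋈⇒Edge : ∀ p q → Bounded p → Bounded q → p ⋈ q → Edge p q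
  ⋈⇒Edge (lo i) (lo j) hᵢ hⱼ (i<j , σj<σi)
    with i ≟ suc n | j ≟ suc n
  ... | yes refl | _ = contradiction (*-cancelʳ-< 2 i j i<j) (≤⇒≯ hⱼ)
  ... | no _ | no _ = contradiction (*-cancelʳ-< 2 i j i<j)
    (≤⇒≯ (s≤s⁻¹ (*-cancelʳ-≤ (suc j) (suc i) 2 (<⇒≤ (s≤s⁻¹ σj<σi)))))
  ... | no _ | yes refl
    with refl ← ≤-antisym (s≤s⁻¹ (i*2<1+j*2⇒i≤j (suc n) (suc i) σj<σi))
                          (s≤s⁻¹ (*-cancelʳ-< 2 i (suc n) i<j)) = unmatched (cyclic top)
  ⋈⇒Edge (lo i) (hi zero) _ _ (i<j , _)
    with z≤n ← i*2<1+j*2⇒i≤j i 0 i<j = matched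
  ⋈⇒Edge (lo i) (hi (suc j)) hᵢ hⱼ (i<j , σj<σi) with i ≟ suc n
  ... | yes refl with refl ← ≤-antisym hⱼ (i*2<1+j*2⇒i≤j i (suc j) i<j) = matched
  -- The level gap j + 1 - i is 0, 1 or 2, giving a matching edge, a rung or a rail.
  ... | no _ with m≤n⇒m<n∨m≡n (i*2<1+j*2⇒i≤j i (suc j) i<j)
  ...   | inj₂ refl = matched
  ...   | inj₁ (s≤s i≤j) with m≤n⇒m<n∨m≡n i≤j
  ...     | inj₂ refl = unmatched rung
  ...     | inj₁ i<j′
    with refl ← ≤-antisym i<j′ (i*2<1+j*2⇒i≤j j (suc i) σj<σi) =
    unmatched (cyclic (rail (s≤s⁻¹ hⱼ)))
  -- `σ` never raises a `hi` and never lowers a `lo`, so such a pair keeps its order.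
  ⋈⇒Edge (hi i) (lo j) hᵢ hⱼ (i<j , σj<σi) = ⊥-elim (absurd i (1+i*2<j*2⇒i<j i j i<j) σj<σi)
    where
    absurd : ∀ i → i < j → ¬ code (σ (lo j)) < code (σ (hi i))
    absurd zero    lt lt′ with j ≟ suc n
    absurd zero    (s≤s _) (s≤s ()) | yes _
    absurd zero    lt      (s≤s ()) | no _
    absurd (suc i) lt lt′ with j ≟ suc n
    ... | yes _ = <-asym (*-cancelʳ-< 2 j i lt′) (<-trans (n<1+n i) lt)
    ... | no  _ = <-asym (1+i*2<j*2⇒i<j (suc j) i lt′) (<-trans (<-trans (n<1+n i) lt) (n<1+n j))
  ⋈⇒Edge (hi i) (hi zero) hᵢ hⱼ (s≤s () , σj<σi)
  ⋈⇒Edge (hi zero) (hi (suc zero)) hᵢ hⱼ (i<j , σj<σi) = unmatched (cyclic bottom)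
  ⋈⇒Edge (hi zero) (hi (suc (suc j))) hᵢ hⱼ (i<j , s≤s ())
  ⋈⇒Edge (hi (suc i)) (hi (suc j)) hᵢ hⱼ (s≤s (s≤s (s≤s i<j)) , σj<σi) =
    contradiction i<j (<-asym σj<σi)

  CycleEdge⇒⋈ : ∀ {p q} → CycleEdge p q → p ⋈ q
  CycleEdge⇒⋈ bottom = s≤s (s≤s z≤n) , s≤s z≤n
  -- The codes 2i < 2i + 5 have the images 2i + 3 > 2i + 2: a rail only just crosses.
  CycleEdge⇒⋈ (rail {i} i<n) rewrite σ-lo (<⇒≢ (m<n⇒m<1+n i<n)) =
    s≤s (m≤n+m _ 4) , ≤-refl
  CycleEdge⇒⋈ top rewrite σ-last | σ-lo (<⇒≢ (n<1+n n)) = s≤s (m≤n+m _ 1) , ≤-refl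

  partner⇒⋈ : ∀ i → i ≤ suc n → lo i ⋈ hi i
  partner⇒⋈ zero    _ = ≤-refl , s≤s (s≤s z≤n)
  partner⇒⋈ (suc i) h with suc i ≟ suc n
  ... | yes _ = ≤-refl , s≤s (m≤n+m _ 1)
  ... | no  _ = ≤-refl , s≤s (m≤n+m _ 4)

  -- Transfer from points to vertices.

  size : ℕ
  size = (2 + n) * 2

  point : Fin size → Point
  point u = decode (toℕ u)

  code-point : ∀ u → code (point u) ≡ toℕ u
  code-point u = code-decode (toℕ u)

  point-bounded : ∀ u → Bounded (point u)
  point-bounded u = s≤s⁻¹ (code<⇒level< (point u) (2 + n)
    (subst (_< size) (sym (code-point u)) (toℕ<n u)))

  point-injective : ∀ u v → point u ≡ point v → u ≡ v
  point-injective u v eq =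
    toℕ-injective (trans (sym (code-point u)) (trans (cong code eq) (code-point v)))

  vertexAt : ∀ p → Bounded p → Fin size
  vertexAt p h = fromℕ< (level<⇒code< p (2 + n) (s≤s h))

  point-vertexAt : ∀ p h → point (vertexAt p h) ≡ p
  point-vertexAt p h =
    trans (cong decode (toℕ-fromℕ< (level<⇒code< p (2 + n) (s≤s h)))) (decode-code p)

  -- Serves three maps: `σ` for the permutation, `partner` for the matching and `tour` for the
  -- traversal.
  module Lift (f : Point → Point) (f-bounded : ∀ p → Bounded p → Bounded (f p)) where

    onVertices : Fin size → Fin size
    onVertices u = vertexAt (f (point u)) (f-bounded (point u) (point-bounded u))

    point-onVertices : ∀ u → point (onVertices u) ≡ f (point u)
    point-onVertices u = point-vertexAt (f (point u)) (f-bounded (point u) (point-bounded u))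

    onVertices-involutive : (∀ p → Bounded p → f (f p) ≡ p) →
                            ∀ u → onVertices (onVertices u) ≡ u
    onVertices-involutive inv u = point-injective _ _ (begin
      point (onVertices (onVertices u)) ≡⟨ point-onVertices (onVertices u) ⟩
      f (point (onVertices u))          ≡⟨ cong f (point-onVertices u) ⟩
      f (f (point u))                   ≡⟨ inv (point u) (point-bounded u) ⟩
      point u                           ∎)
      where open ≡-Reasoning

  open Lift

  π : Permutation′ size
  π = permutation (onVertices σ σ-bounded) (onVertices σ σ-bounded) inv inv
    where inv = onVertices-involutive σ σ-bounded σ-involutive

  G : Graph
  G = inversionGraph π

  open Graph G using (Vertex; Adj)

  crossing-code : ∀ u v →
    point u ⋈ point v ≡ Crossing (toℕ u) (toℕ v) (toℕ (π ⟨$⟩ʳ u)) (toℕ (π ⟨$⟩ʳ v))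
  crossing-code u v =
    cong₂ _×_ (cong₂ _<_ (code-point u) (code-point v)) (cong₂ _<_ (code-σ v) (code-σ u))
    where
    code-σ : ∀ w → code (σ (point w)) ≡ toℕ (π ⟨$⟩ʳ w)
    code-σ w = trans (cong code (sym (point-onVertices σ σ-bounded w))) (code-point (π ⟨$⟩ʳ w))

  ⋈⇒Adj : ∀ u v → point u ⋈ point v → Adj u v
  ⋈⇒Adj u v c = crossing⇒inversion π (subst id (crossing-code u v) c)

  Adj⇒Edge : ∀ u v → Adj u v → Edge (point u) (point v) ⊎ Edge (point v) (point u)
  Adj⇒Edge u v uv with inversion⇒crossing π uv
  ... | inj₁ c = inj₁ (⋈⇒Edge _ _ (point-bounded u) (point-bounded v)
                         (subst id (sym (crossing-code u v)) c))
  ... | inj₂ c = inj₂ (⋈⇒Edge _ _ (point-bounded v) (point-bounded u)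
                         (subst id (sym (crossing-code v u)) c))

  CycleEdge⇒Adj : ∀ u v → CycleEdge (point u) (point v) → Adj u v
  CycleEdge⇒Adj u v = ⋈⇒Adj u v ∘ CycleEdge⇒⋈

  -- The matching and the cycle edges.

  partner-bounded : ∀ p → Bounded p → Bounded (partner p)
  partner-bounded (lo i) h = h
  partner-bounded (hi i) h = h

  mate : Vertex → Vertex
  mate = onVertices partner partner-bounded

  point-mate : ∀ u → point (mate u) ≡ partner (point u)
  point-mate = point-onVertices partner partner-bounded

  mate-involutive : ∀ u → mate (mate u) ≡ u
  mate-involutive = onVertices-involutive partner partner-bounded (λ p _ → partner-involutive p)

  mate-swap : ∀ {u v} → mate u ≡ v → mate v ≡ u
  mate-swap {u} refl = mate-involutive u

  mate-adjacent : ∀ u → Adj u (mate u)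
  mate-adjacent u = adjacent u (mate u) (point u) refl (point-mate u) (point-bounded u)
    where
    adjacent : ∀ u v p → point u ≡ p → point v ≡ partner p → Bounded p → Adj u v
    adjacent u v (lo i) eq eq′ h = ⋈⇒Adj u v (subst₂ _⋈_ (sym eq) (sym eq′) (partner⇒⋈ i h))
    adjacent u v (hi i) eq eq′ h =
      Graph.symm G {v} {u} (⋈⇒Adj v u (subst₂ _⋈_ (sym eq′) (sym eq) (partner⇒⋈ i h)))

  M : Matching G
  M = record
    { Mem      = λ u v → mate u ≡ v
    ; mem?     = λ u v → mate u Fin.≟ v
    ; symm     = mate-swap
    ; edges    = λ { {u} refl → mate-adjacent u }
    ; disjoint = disjoint
    }
    where
    disjoint : ∀ {u v x y} → mate u ≡ v → mate x ≡ y → SamePair u v x y ⊎ DisjointPairs u v x y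
    disjoint {u} {v} {x} {y} uv xy with u Fin.≟ x | u Fin.≟ y
    ... | yes refl | _        = inj₁ (inj₁ (refl , trans (sym uv) xy))
    ... | no _     | yes refl = inj₁ (inj₂ (refl , trans (sym uv) (mate-swap xy)))
    ... | no u≢x   | no u≢y   = inj₂ (u≢x , u≢y , v≢x , v≢y)
      where
      v≢x : v ≢ x
      v≢x refl = u≢y (trans (sym (mate-swap uv)) xy)
      v≢y : v ≢ y
      v≢y refl = u≢x (trans (sym (mate-swap uv)) (mate-swap xy))

  _—_ : Point → Point → Set
  p — q = CycleEdge p q ⊎ CycleEdge q p

  —⇒Adj : ∀ u v → point u — point v → Adj u v
  —⇒Adj u v (inj₁ e) = CycleEdge⇒Adj u v e
  —⇒Adj u v (inj₂ e) = Graph.symm G {v} {u} (CycleEdge⇒Adj v u e)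

  -- The intended cycle is Hamiltonian. In `edges` this makes D visit every vertex and hence contain
  -- every matching edge.
  —-total : ∀ p → Bounded p → ∃[ q ] p — q
  —-total (hi zero)          _ = _ , inj₁ bottom
  —-total (hi (suc zero))    _ = _ , inj₂ bottom
  —-total (hi (suc (suc i))) h = _ , inj₂ (rail (s≤s⁻¹ h))
  —-total (lo i)             h with m≤n⇒m<n∨m≡n h
  ... | inj₂ refl = _ , inj₂ top
  ... | inj₁ i<1+n with m≤n⇒m<n∨m≡n (s≤s⁻¹ i<1+n)
  ...   | inj₂ refl = _ , inj₁ top
  ...   | inj₁ i<n  = _ , inj₁ (rail i<n)

  -- Uniqueness of the alternating cycle.

  module Uniqueness (D : AlternatingCycle M) where
    open AlternatingCycle D using (HasEdge)
    open Alternation D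

    _~_ : Point → Point → Set
    p ~ q = ∃[ u ] ∃[ v ] point u ≡ p × point v ≡ q × FreeEdge u v

    ~-sym : ∀ {p q} → p ~ q → q ~ p
    ~-sym (u , v , p , q , e) = v , u , q , p , FreeEdge-sym e

    ~-functional : ∀ {p q r} → p ~ q → p ~ r → q ≡ r
    ~-functional (u , v , refl , refl , e) (u′ , v′ , eq , refl , e′)
      with refl ← point-injective u′ u eq = cong point (FreeEdge-functional e e′)

    ~-bounded : ∀ {p q} → p ~ q → Bounded q
    ~-bounded (_ , v , _ , refl , _) = point-bounded v

    ~⇒Unmatched : ∀ {p q} → p ~ q → Unmatched p q ⊎ Unmatched q p
    ~⇒Unmatched (u , v , refl , refl , e) = helper (Adj⇒Edge u v (FreeEdge⇒Adj e)) ≢partner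
      where
      ≢partner : partner (point u) ≢ point v
      ≢partner eq = FreeEdge⇒¬Mem e (point-injective _ v (trans (point-mate u) eq))
      helper : ∀ {p q} → Edge p q ⊎ Edge q p → partner p ≢ q → Unmatched p q ⊎ Unmatched q p
      helper (inj₁ matched)       ≢ = contradiction refl ≢
      helper (inj₂ matched)       ≢ = contradiction refl ≢
      helper (inj₁ (unmatched e)) _ = inj₁ e
      helper (inj₂ (unmatched e)) _ = inj₂ e

    Visited : Point → Set
    Visited p = ∃[ q ] p ~ q

    -- D contains the matching edge at a visited vertex, hence also the other end of that edge.
    partner-visited : ∀ {p} → Visited p → Visited (partner p)
    partner-visited (_ , u , _ , refl , _ , e)
      with w , e′ ← HasEdge⇒freeEdge (FreeEdge⇒matched e refl) =
      point w , mate u , w , point-mate u , refl , e′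

    -- Unless it is `bottom`, the free edge at `hi i` is a rung or a rail to some `lo j` with j < i,
    -- and the matching edge leads on to `hi j`.
    descend : ∀ i → Visited (hi i) → Visited (hi 0)
    descend i (q , e) with ~⇒Unmatched e
    ... | inj₁ (cyclic bottom)       = q , e
    ... | inj₂ (cyclic bottom)       = _ , ~-sym e
    ... | inj₂ (rung {j})            = descend j (partner-visited (_ , ~-sym e))
    ... | inj₂ (cyclic (rail {j} _)) = descend j (partner-visited (_ , ~-sym e))

    start-visited : Visited (hi 0)
    start-visited with u , w , e ← firstFreeEdge = from (point u) (_ , u , w , refl , refl , e)
      where
      from : ∀ p → Visited p → Visited (hi 0)
      from (hi i) = descend i
      from (lo i) = descend i ∘ partner-visited

    -- Besides its partner, `hi 0` has only one neighbour.
    bottom~ : hi 0 ~ hi 1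
    bottom~ with q , e ← start-visited with ~⇒Unmatched e
    ... | inj₁ (cyclic bottom) = e
    ... | inj₂ (cyclic ())

    -- The free edge at hi (suc i) is not the rung, so the one at lo i is not either.
    RungAvoided : ℕ → Set
    RungAvoided i = (∃[ q ] q ≢ lo i × hi (suc i) ~ q) × Visited (lo i)

    -- Apart from the rung, the edges at `lo i` outside the matching are the rail upwards and, at
    -- the last two levels, `top`.
    forced : ∀ {i} → RungAvoided i →
             lo i ~ hi (2 + i) ⊎ (i ≡ n × lo n ~ lo (suc n)) ⊎ i ≡ suc n
    forced ((q , q≢ , e) , r , e′) with ~⇒Unmatched e′
    ... | inj₁ rung              = contradiction (~-functional e (~-sym e′)) q≢
    ... | inj₁ (cyclic (rail _)) = inj₁ e′
    ... | inj₁ (cyclic top)      = inj₂ (inj₁ (refl , e′))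
    ... | inj₂ (cyclic top)      = inj₂ (inj₂ refl)

    -- Induction along the columns: the rail forced at `lo i` is the free edge of `hi (2 + i)`,
    -- which thus avoids the next rung, and `lo (suc i)` is visited as the partner of `hi (suc i)`.
    rung-avoided : ∀ i → i ≤ n → RungAvoided i
    rung-avoided zero    _ = (_ , (λ ()) , ~-sym bottom~) , partner-visited start-visited
    rung-avoided (suc i) i<n with prev@((_ , _ , e) , _) ← rung-avoided i (<⇒≤ i<n)
      with forced prev
    ... | inj₁ e′                 = (_ , (λ ()) , ~-sym e′) , partner-visited (_ , e)
    ... | inj₂ (inj₁ (refl , _)) = contradiction i<n (<-irrefl refl)
    ... | inj₂ (inj₂ refl)       = contradiction i<n (<⇒≱ (m<n⇒m<1+n (n<1+n n)))

    CycleEdge⇒~ : ∀ {p q} → CycleEdge p q → p ~ q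
    CycleEdge⇒~ bottom = bottom~
    CycleEdge⇒~ (rail i<n) with forced (rung-avoided _ (<⇒≤ i<n))
    ... | inj₁ e                 = e
    ... | inj₂ (inj₁ (refl , _)) = contradiction i<n (<-irrefl refl)
    ... | inj₂ (inj₂ refl)       = contradiction i<n (<-asym (n<1+n n))
    CycleEdge⇒~ top with forced (rung-avoided n ≤-refl)
    ... | inj₂ (inj₁ (_ , e)) = e
    ... | inj₂ (inj₂ eq)      = contradiction eq (<⇒≢ (n<1+n n))
    -- A rail from `lo n` would end at level n + 2, above the last level.
    ... | inj₁ e              = contradiction (~-bounded e) (<⇒≱ ≤-refl)

    ~⇒— : ∀ {p q} → p ~ q → p — q
    ~⇒— e with ~⇒Unmatched e
    ... | inj₁ (cyclic e′) = inj₁ e′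
    ... | inj₂ (cyclic e′) = inj₂ e′
    ... | inj₁ rung with (_ , ≢ , e′) , _ ← rung-avoided _ (s≤s⁻¹ (~-bounded e)) =
      contradiction (~-functional e′ (~-sym e)) ≢
    ... | inj₂ rung with (_ , ≢ , e′) , _ ← rung-avoided _ (s≤s⁻¹ (~-bounded (~-sym e))) =
      contradiction (~-functional e′ e) ≢

    —⇒~ : ∀ {p q} → p — q → p ~ q
    —⇒~ (inj₁ e) = CycleEdge⇒~ e
    —⇒~ (inj₂ e) = ~-sym (CycleEdge⇒~ e)

    —⇒FreeEdge : ∀ {u v} → point u — point v → FreeEdge u v
    —⇒FreeEdge {u} {v} e with u′ , v′ , p , q , e′ ← —⇒~ e
      with refl ← point-injective u′ u p | refl ← point-injective v′ v q = e′

    -- The right-hand side does not depend on D, so any two alternating cycles have the same edges.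
    edges : ∀ u v → HasEdge u v ⇔ (mate u ≡ v ⊎ point u — point v)
    edges u v = mk⇔ to from
      where
      to : HasEdge u v → mate u ≡ v ⊎ point u — point v
      to e = map₂ (λ e′ → ~⇒— (u , v , refl , refl , e′)) (HasEdge⇒Mem⊎FreeEdge e)
      from : mate u ≡ v ⊎ point u — point v → HasEdge u v
      from (inj₂ e) = FreeEdge⇒HasEdge (—⇒FreeEdge {u} {v} e)
      from (inj₁ m) with _ , e ← —-total (point u) (point-bounded u)
        with u′ , _ , p , _ , e′ ← —⇒~ e
        with refl ← point-injective u′ u p = FreeEdge⇒matched e′ m

  -- Existence: a traversal of the cycle.

  -- The cycle meets the matching edges at levels 1, 3, 5, … in ascending order,
  -- from hi to lo, and then those at even levels in descending order, from lo
  -- to hi.  The t-th matching edge is entered at enter t r, where t + r = n + 1.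
  enter : ℕ → ℕ → Point
  enter t r with t <? r
  ... | yes _ = hi (suc (t * 2))
  ... | no  _ = lo (r * 2)

  -- The argument is a position on the cycle written as a point: position 2t enters the t-th
  -- matching edge, position 2t + 1 is its other end.
  tour : Point → Point
  tour (lo t) = enter t (suc n ∸ t)
  tour (hi t) = partner (enter t (suc n ∸ t))

  i*2≡i+i : ∀ i → i * 2 ≡ i + i
  i*2≡i+i i = trans (*-comm i 2) (cong (i +_) (+-identityʳ i))

  enter-bounded : ∀ t r → t + r ≡ suc n → Bounded (enter t r)
  enter-bounded t r eq with t <? r
  ... | yes t<r = subst₂ _<_ (sym (i*2≡i+i t)) eq (+-monoʳ-< t t<r)
  ... | no  t≮r = subst₂ _≤_ (sym (i*2≡i+i r)) eq (+-monoˡ-≤ r (≮⇒≥ t≮r))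

  tour-bounded : ∀ p → Bounded p → Bounded (tour p)
  tour-bounded (lo t) h = enter-bounded t (suc n ∸ t) (m+[n∸m]≡n h)
  tour-bounded (hi t) h =
    partner-bounded (enter t (suc n ∸ t)) (enter-bounded t (suc n ∸ t) (m+[n∸m]≡n h))

  double≢1+double : ∀ i j → i * 2 ≢ suc (j * 2)
  double≢1+double i j eq =
    suc-odd (divides i refl) (subst (2 ∣_) (cong suc (sym eq)) (divides (suc j) refl))

  enter-injective : ∀ t r t′ r′ → t + r ≡ suc n → t′ + r′ ≡ suc n →
                    enter t r ≡ enter t′ r′ → t ≡ t′
  enter-injective t r t′ r′ p q eq with t <? r | t′ <? r′
  ... | yes _ | yes _ = *-cancelʳ-≡ t t′ 2 (suc-injective (cong level eq))
  ... | no _  | no _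
    with refl ← *-cancelʳ-≡ r r′ 2 (cong level eq) = +-cancelʳ-≡ r t t′ (trans p (sym q))
  enter-injective t r t′ r′ p q () | yes _ | no _
  enter-injective t r t′ r′ p q () | no _ | yes _

  -- Within one sweep entries and exits lie on opposite sides; between the sweeps the levels differ
  -- in parity.
  enter≢exit : ∀ t r t′ r′ → enter t r ≢ partner (enter t′ r′)
  enter≢exit t r t′ r′ eq with t <? r | t′ <? r′
  ... | yes _ | no _  = double≢1+double r′ t (sym (cong level eq))
  ... | no _  | yes _ = double≢1+double r t′ (cong level eq)
  enter≢exit t r t′ r′ () | yes _ | yes _
  enter≢exit t r t′ r′ () | no _ | no _

  tour-injective : ∀ p q → Bounded p → Bounded q → tour p ≡ tour q → p ≡ q
  tour-injective (lo t) (lo t′) h h′ eq =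
    cong lo (enter-injective t _ t′ _ (m+[n∸m]≡n h) (m+[n∸m]≡n h′) eq)
  tour-injective (lo t) (hi t′) h h′ eq = contradiction eq (enter≢exit t _ t′ _)
  tour-injective (hi t) (lo t′) h h′ eq = contradiction (sym eq) (enter≢exit t′ _ t _)
  tour-injective (hi t) (hi t′) h h′ eq =
    cong hi (enter-injective t _ t′ _ (m+[n∸m]≡n h) (m+[n∸m]≡n h′)
      (trans (sym (partner-involutive _)) (trans (cong partner eq) (partner-involutive _))))

  link : ∀ t r → t + r ≡ n → partner (enter t (suc r)) — enter (suc t) r
  link t r eq with t <? suc r | suc t <? r
  ... | yes _     | yes t<r = inj₁ (rail (subst₂ _<_ (cong suc (sym (i*2≡i+i t))) eq 1+t+t<t+r))
    where
    1+t+t<t+r : suc (t + t) < t + r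
    1+t+t<t+r = subst (_< t + r) (+-suc t t) (+-monoʳ-< t t<r)
  ... | no  t≮1+r | yes t<r = contradiction (<-trans (n<1+n t) (<-trans t<r (n<1+n r))) t≮1+r
  ... | no  t≮1+r | no  _   =
    inj₂ (rail (subst₂ _<_ (sym (i*2≡i+i r)) eq (+-monoˡ-< r (≮⇒≥ t≮1+r))))
  -- The turn between the sweeps uses `top`. Its direction depends on the parity of n = t + r, as r
  -- is t or t + 1.
  ... | yes t<1+r | no  t≮r with m≤n⇒m<n∨m≡n (s≤s⁻¹ t<1+r)
  ...   | inj₂ refl with refl ← trans (i*2≡i+i t) eq = inj₂ top
  ...   | inj₁ t<r with refl ← ≤-antisym t<r (≮⇒≥ t≮r)
    with refl ← trans (cong suc (i*2≡i+i t)) (trans (sym (+-suc t t)) eq) = inj₁ top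

  -- The graph of `next` in point form, which exposes the parity of a position.
  data Follows : Point → Point → Set where
    across : ∀ {t} → Follows (lo t) (hi t)
    up     : ∀ {t} → t ≤ n → Follows (hi t) (lo (suc t))
    around : Follows (hi (suc n)) (lo 0)

  follows : ∀ i → Follows (point i) (point (next i))
  follows i with toℕ-next i
  ... | inj₁ eq = subst (Follows (point i)) (cong decode (sym eq′))
                    (helper (point i) (subst (_< size) eq′ (toℕ<n (next i))))
    where
    eq′ : toℕ (next i) ≡ suc (code (point i))
    eq′ = trans eq (cong suc (sym (code-point i)))
    helper : ∀ p → suc (code p) < size → Follows p (decode (suc (code p)))
    helper (lo t) _ = subst (Follows (lo t)) (sym (decode-code (hi t))) across
    helper (hi t) h = subst (Follows (hi t)) (sym (decode-code (lo (suc t))))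
      (up (s≤s⁻¹ (s≤s⁻¹ (*-cancelʳ-< 2 (suc t) (2 + n) h))))
  ... | inj₂ (eq , eq′) = subst (Follows (point i)) (cong decode (sym eq′))
                            (helper (point i) (trans (cong suc (code-point i)) eq))
    where
    helper : ∀ p → suc (code p) ≡ size → Follows p (lo 0)
    helper (lo t) eq = contradiction (sym eq) (double≢1+double (2 + n) t)
    helper (hi t) eq with refl ← suc-injective (*-cancelʳ-≡ (suc t) (2 + n) 2 eq) = around

  tour-step : ∀ {p q} → Follows p q → partner (tour p) ≡ tour q ⊎ tour p — tour q
  tour-step across = inj₁ refl
  -- With r = n - t, the second argument of `enter` at t becomes `suc r`, as in `link`.
  tour-step (up {t} h) rewrite +-∸-assoc 1 h = inj₂ (link t (n ∸ t) (m+[n∸m]≡n h))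
  -- The descending sweep ends at `hi 0` and the ascending one starts at `hi 1`.
  tour-step around rewrite n∸n≡0 n = inj₂ (inj₁ bottom)

  position : Fin size → Vertex
  position = onVertices tour tour-bounded

  point-position : ∀ i → point (position i) ≡ tour (point i)
  point-position = point-onVertices tour tour-bounded

  position-mate : ∀ i → partner (tour (point i)) ≡ tour (point (next i)) →
                  mate (position i) ≡ position (next i)
  position-mate i eq = point-injective _ _ (begin
    point (mate (position i))    ≡⟨ point-mate (position i) ⟩
    partner (point (position i)) ≡⟨ cong partner (point-position i) ⟩
    partner (tour (point i))     ≡⟨ eq ⟩
    tour (point (next i))        ≡⟨ point-position (next i) ⟨
    point (position (next i))    ∎)
    where open ≡-Reasoning

  C : AlternatingCycle M
  C = record
    { cycle = record
      { length    = size
      ; 3≤length  = s≤s (s≤s (s≤s z≤n))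
      ; vertex    = position
      ; injective = λ {i} {j} eq → point-injective i j
          (tour-injective _ _ (point-bounded i) (point-bounded j)
            (trans (sym (point-position i)) (trans (cong point eq) (point-position j))))
      ; adjacent  = adjacent
      }
    ; even        = divides (2 + n) refl
    ; alternating = inj₁ alternating
    }
    where
    adjacent : ∀ i → Adj (position i) (position (next i))
    adjacent i with tour-step (follows i)
    ... | inj₁ eq = subst (Adj (position i)) (position-mate i eq) (mate-adjacent (position i))
    ... | inj₂ e  = —⇒Adj (position i) (position (next i))
      (subst₂ _—_ (sym (point-position i)) (sym (point-position (next i))) e)

    alternating : ∀ i → 2 ∣ toℕ i → mate (position i) ≡ position (next i)
    alternating i 2∣i =
      position-mate i (helper (follows i) (subst (2 ∣_) (sym (code-point i)) 2∣i))
      where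
      helper : ∀ {p q} → Follows p q → 2 ∣ code p → partner (tour p) ≡ tour q
      helper across     _   = refl
      helper (up {t} _) odd = contradiction odd (suc-odd (divides t refl))
      helper around     odd = contradiction odd (suc-odd (divides (suc n) refl))

theorem11 : (k : ℕ) → 2 ∣ k → 4 ≤ k →
    Σ[ G ∈ Graph ] IsPermutationGraph G ×
    (Σ[ M ∈ Matching G ] Σ[ C ∈ AlternatingCycle M ]
    AlternatingCycle.length C ≡ k × (∀ (D : AlternatingCycle M) → D ≈ C))
theorem11 .(1 * 2) (divides-refl 1) (s≤s (s≤s ()))
-- Half of k is n + 2, the number of levels. D is compared with C by applying `edges` to both.
theorem11 .((2 + n) * 2) (divides-refl (suc (suc n))) _ =
  G , (size , π , record { bijection = ↔-id _ ; preserves = λ _ _ → mk⇔ id id }) ,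
  M , C , refl , λ D u v →
    mk⇔ (from (Uniqueness.edges C u v) ∘ to (Uniqueness.edges D u v))
        (from (Uniqueness.edges D u v) ∘ to (Uniqueness.edges C u v))
  where
  open Ladder n
  open Equivalence
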